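{- Let $r\ge 1$, let $\tau$ be a bijection from $F^r$ to $F^r$ with $\tau({\bf 0})={\bf 0}$, and let $k$ be the deficiency of $\tau$. Let $S_{\mathcal H,\tau}=\bigcup_{a\in F^r}\mathcal H_a\times\mathcal H_{\tau(a)}$. Then $$\dim(\mathrm{Ker}(S_{\mathcal H,\tau}))=2^{r+1}-r-2-k.$$
   Context: $F=\mathrm{GF}(2)$; a code of length $n$ is a set of vectors of $F^n$. $\mathrm{wt}$ is Hamming weight. ${\bf 0}$ denotes the all-zero vector. The kernel $\mathrm{Ker}(C)$ of a code $C$ of length $n$ is the set of all $x\in F^n$ with $x+C=C$ (a linear subspace). The coordinates of $F^{2^r}$ are indexed by the vectors of $F^r$; $e_a$ is the vector whose only nonzero coordinate is the one indexed by $a$. $\mathcal H=\{c\in F^{2^r}:\sum_{a:c_a=1}a={\bf 0},\ \mathrm{wt}(c)\equiv 0 \pmod 2\}$, and $\mathcal H_a=\mathcal H+e_a+e_{\bf 0}$ for $a\in F^r$. For codes $C,D$, $C\times D=\{x|y: x\in C,\ y\in D\}$, where $x|y$ is concatenation. For nonzero $a\in F^r$, $\mathrm{Star}(a)=\{\{a,b,a+b\}: b\in F^r\setminus\{{\bf 0},a\}\}$ (the supports of the weight-3 codewords, having a one in coordinate $a$, of the Hamming code $\mathcal H'=\{c\in F^{2^r-1}:\sum_{a:c_a=1}a={\bf 0}\}$, whose coordinates are indexed by nonzero vectors of $F^r$). For a bijection $\tau:F^r\to F^r$ fixing ${\bf 0}$, $\tau(\mathrm{Star}(a))=\{\{\tau(a),\tau(b),\tau(a+b)\}: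 b\in F^r\setminus\{{\bf 0},a\}\}$. The number of nonzero $a$ with $\tau(\mathrm{Star}(a))=\mathrm{Star}(\tau(a))$ is always a power of two minus one, and the deficiency of $\tau$ is $r-\log_2\left(|\{a\in F^r\setminus\{{\bf 0}\}:\tau(\mathrm{Star}(a))=\mathrm{Star}(\tau(a))\}|+1\right)$. -}

module Defs where

open import Data.Bool.Base using (Bool; true; false; _xor_; _∧_)
open import Data.Bool.Properties using () renaming (_≟_ to _≟ᵇ_)
open import Data.Fin.Base using (Fin; zero)
open import Data.Fin.Properties using (2↔Bool; *↔×)
open import Data.Fin.Subset using (Subset; ⁅_⁆; _∪_; ∣_∣)
open import Data.Fin.Subset.Properties using (anySubset?)
open import Data.List.Base as List using (List; allFin; filter; length)
open import Data.Nat.Base using (ℕ; zero; suc; _+_; _∸_; _^_)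
open import Data.Nat.Divisibility using (_∣_)
open import Data.Nat.Logarithm using (⌊log₂_⌋)
open import Data.Product.Base using (_×_; _,_; ∃; ∃-syntax; ∃₂; uncurry)
open import Data.Product.Function.NonDependent.Propositional using (_×-↔_)
open import Data.Vec.Base using (Vec; []; _∷_; foldr′; lookup; map; replicate; zipWith; _++_; uncons)
open import Data.Vec.Properties using (≡-dec)
open import Function.Bundles using (_↔_; mk↔ₛ′; Inverse)
open import Function.Construct.Composition using (_↔-∘_)
open import Function.Construct.Symmetry using (↔-sym)
open import Level using (0ℓ)
open import Relation.Binary.Definitions using (DecidableEquality)
open import Relation.Binary.PropositionalEquality using (_≡_; _≢_; refl)
open import Relation.Nullary.Decidable using (Dec; yes; no; ¬?; _×-dec_; decidable-stable)
open import Relation.Unary using (Pred; Decidable; _⊆_; _≐_; _∈_; ⋃)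

private
  variable
    n m d r : ℕ

-- GF(2) is Bool with _xor_ and _∧_.  As Subset n is also Vec Bool n,
-- a vector doubles as its own support.
F^_ : ℕ → Set
F^ n = Vec Bool n

infixl 6 _⊕_
_⊕_ : F^ n → F^ n → F^ n
_⊕_ = zipWith _xor_

𝟎 : F^ n
𝟎 = replicate _ false

infixr 7 _·_
_·_ : Bool → F^ n → F^ n
c · v = map (c ∧_) v

_≟ᵛ_ : DecidableEquality (F^ n)
_≟ᵛ_ = ≡-dec _≟ᵇ_

wt : F^ n → ℕ
wt = ∣_∣

Code : ℕ → Set₁
Code n = Pred (F^ n) 0ℓ

infixr 6 _⊞_
_⊞_ : F^ n → Code n → Code n
(x ⊞ C) y = ∃[ c ] c ∈ C × y ≡ x ⊕ c

infixr 7 _⊠_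
_⊠_ : Code n → Code m → Code (n + m)
(C ⊠ D) z = ∃₂ λ x y → x ∈ C × y ∈ D × z ≡ x ++ y

Ker : Code n → Code n
Ker C x = (x ⊞ C) ≐ C

combination : Vec Bool d → Vec (F^ n) d → F^ n
combination cs vs = foldr′ _⊕_ 𝟎 (zipWith _·_ cs vs)

LinearlyIndependent : Vec (F^ n) d → Set
LinearlyIndependent vs = ∀ cs → combination cs vs ≡ 𝟎 → cs ≡ 𝟎

Span : Vec (F^ n) d → Code n
Span vs v = ∃[ cs ] v ≡ combination cs vs

-- The spanning condition also says that V is a linear subspace.
HasDimension : Code n → ℕ → Set
HasDimension {n} V d =
  ∃ λ (vs : Vec (F^ n) d) → LinearlyIndependent vs × Span vs ≐ V

-- The indexing of the 2 ^ r coordinates by the vectors of F^ r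
-- (binary expansion, most significant digit first).
coordinates : ∀ r → F^ r ↔ Fin (2 ^ r)
coordinates zero =
  mk↔ₛ′ (λ _ → zero) (λ _ → []) (λ { zero → refl }) (λ { [] → refl })
coordinates (suc r) =
  ↔-sym *↔× ↔-∘ ((↔-sym 2↔Bool ×-↔ coordinates r) ↔-∘ cons↔)
  where
  cons↔ : F^ (suc r) ↔ (Bool × F^ r)
  cons↔ = mk↔ₛ′ uncons (uncurry _∷_) (λ _ → refl) (λ { (_ ∷ _) → refl })

index : F^ r → Fin (2 ^ r)
index {r} = Inverse.to (coordinates r)

vectors : ∀ r → List (F^ r)
vectors r = List.map (Inverse.from (coordinates r)) (allFin (2 ^ r))

e : F^ r → F^ (2 ^ r)
e a = ⁅ index a ⁆

supportSum : F^ (2 ^ r) → F^ r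
supportSum {r} c =
  List.foldr _⊕_ 𝟎 (filter (λ a → lookup c (index a) ≟ᵇ true) (vectors r))

ℋ : ∀ r → Code (2 ^ r)
ℋ r c = supportSum {r} c ≡ 𝟎 × 2 ∣ wt c

ℋ[_] : F^ r → Code (2 ^ r)
ℋ[_] {r} a = (e a ⊕ e {r} 𝟎) ⊞ ℋ r

S : (F^ r → F^ r) → Code (2 ^ r + 2 ^ r)
S {r} τ = ⋃[ a ∶ F^ r ] (ℋ[ a ] ⊠ ℋ[ τ a ])

-- A set of vectors of F^ r is encoded as the subset of their indices.
⟅_,_,_⟆ : F^ r → F^ r → F^ r → Subset (2 ^ r)
⟅ a , b , c ⟆ = ⁅ index a ⁆ ∪ ⁅ index b ⁆ ∪ ⁅ index c ⁆

Star : F^ r → Pred (Subset (2 ^ r)) 0ℓ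
Star a B = ∃[ b ] b ≢ 𝟎 × b ≢ a × B ≡ ⟅ a , b , a ⊕ b ⟆

StarImage : (F^ r → F^ r) → F^ r → Pred (Subset (2 ^ r)) 0ℓ
StarImage τ a B = ∃[ b ] b ≢ 𝟎 × b ≢ a × B ≡ ⟅ τ a , τ b , τ (a ⊕ b) ⟆

PreservesStar : (F^ r → F^ r) → Pred (F^ r) 0ℓ
PreservesStar τ a = a ≢ 𝟎 × StarImage τ a ≐ Star (τ a)

private
  ⊆-dec : {P Q : Pred (Subset n) 0ℓ} → Decidable P → Decidable Q → Dec (P ⊆ Q)
  ⊆-dec P? Q? with anySubset? (λ B → P? B ×-dec ¬? (Q? B))
  ... | yes (_ , p , ¬q) = no λ P⊆Q → ¬q (P⊆Q p)
  ... | no ¬∃ = yes λ {B} p → decidable-stable (Q? B) λ ¬q → ¬∃ (B , p , ¬q)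

star? : (a : F^ r) → Decidable (Star a)
star? a B = anySubset? λ b →
  ¬? (b ≟ᵛ 𝟎) ×-dec ¬? (b ≟ᵛ a) ×-dec (B ≟ᵛ ⟅ a , b , a ⊕ b ⟆)

starImage? : (τ : F^ r → F^ r) (a : F^ r) → Decidable (StarImage τ a)
starImage? τ a B = anySubset? λ b →
  ¬? (b ≟ᵛ 𝟎) ×-dec ¬? (b ≟ᵛ a) ×-dec (B ≟ᵛ ⟅ τ a , τ b , τ (a ⊕ b) ⟆)

preservesStar? : (τ : F^ r → F^ r) → Decidable (PreservesStar τ)
preservesStar? τ a = ¬? (a ≟ᵛ 𝟎) ×-dec
  ⊆-dec (starImage? τ a) (star? (τ a)) ×-dec
  ⊆-dec (star? (τ a)) (starImage? τ a)

-- For a bijection τ fixing 𝟎 the argument of the logarithm is a power of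
-- two at most 2 ^ r, so neither the floor nor _∸_ loses anything.
deficiency : (F^ r → F^ r) → ℕ
deficiency {r} τ =
  r ∸ ⌊log₂ (length (filter (preservesStar? τ) (vectors r)) + 1) ⌋

{-# OPTIONS --safe #-}

-- A word has a syndrome, its parity followed by its support sum; the syndrome is linear, and
-- ℋ[ a ] is the set of words with syndrome false ∷ a.  As 𝟎 lies in S, the kernel of S lies in S,
-- and u | v ∈ S lies in the kernel iff a, the support sum of u, satisfies
-- τ (a ⊕ b) ≡ τ a ⊕ τ b for all b.  These a form a subspace A.  Mapping u | v to a is linear on the
-- kernel, with image A, and its null space ℋ ⊠ ℋ is the null space of the surjective pair of
-- syndromes, so that by rank-nullity dim Ker S = dim A + 2 ^ (r + 1) - 2 (r + 1).  Finally a ≢ 𝟎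
-- is in A iff τ preserves its star, so counting gives dim A = r - k.

module Submission where

open import Defs
open import Algebra.Bundles using (CommutativeMonoid)
open import Algebra.Properties.CommutativeSemigroup using (interchange)
open import Data.Bool.Base using (Bool; true; false; not; _xor_)
open import Data.Bool.Properties
  using (not-involutive; xor-same; xor-assoc; xor-comm; xor-identityˡ; xor-identityʳ)
  renaming (_≟_ to _≟ᵇ_)
open import Data.Fin.Subset using (⁅_⁆; _∪_) renaming (_∈_ to _∈ˢ_)
open import Data.Fin.Subset.Properties
  using (x∈p∪q⁻; x∈p∪q⁺; x∈⁅y⁆⇒x≡y; x∈⁅x⁆; ∣⁅x⁆∣≡1)
open import Data.List.Base as List using (List; filter; length; [_])
open import Data.List.Membership.Propositional using () renaming (_∈_ to _∈ˡ_)
open import Data.List.Membership.Propositional.Properties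
  using (∈-filter⁺; ∈-filter⁻; ∈-map⁺; ∈-map⁻; ∈-allFin)
open import Data.List.Membership.Propositional.Properties.WithK using (unique∧set⇒bag)
open import Data.List.Properties using (length-map; length-tabulate; length-filter; filter-all)
open import Data.List.Relation.Binary.BagAndSetEquality using (∼bag⇒↭)
open import Data.List.Relation.Binary.Permutation.Propositional using (_↭_)
open import Data.List.Relation.Binary.Permutation.Propositional.Properties
  using (↭-length; ↭-singleton-inv)
import Data.List.Relation.Unary.All as All
import Data.List.Relation.Unary.AllPairs as AllPairs
open import Data.List.Relation.Unary.Any using (here; there)
open import Data.List.Relation.Unary.Unique.Propositional using (Unique)
import Data.List.Relation.Unary.Unique.Propositional.Properties as Unique
open import Data.Nat.Base using (ℕ; zero; suc; _+_; _∸_; _^_; _≤_)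
open import Data.Nat.Divisibility using (_∣_; divides; _∣0; ∣m∣n⇒∣m+n; ∣-refl)
open import Data.Nat.Logarithm using (⌊log₂_⌋; ⌊log₂⌋-mono-≤; ⌊log₂[2^n]⌋≡n)
open import Data.Nat.Properties
  using (module ≤-Reasoning; +-comm; +-assoc; +-identityʳ; m+n∸m≡n; m∸n+n≡m)
open import Data.Nat.Solver using (module +-*-Solver)
open +-*-Solver using (solve; con; _:+_; _:=_)
open import Data.Product.Base using (_×_; _,_; ∃-syntax; proj₁; proj₂)
open import Data.Sum.Base using (_⊎_; inj₁; inj₂)
open import Data.Vec.Base using (Vec; []; _∷_; _++_; drop; foldr′; lookup; map; tail; take)
open import Data.Vec.Properties
  using (++-injective; []=⇒lookup; drop-zipWith; lookup-zipWith; lookup⇒[]=; map-const; map-id;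
         take++drop≡id; take-zipWith; zipWith-++; zipWith-assoc; zipWith-comm;
         zipWith-identityʳ; zipWith-identityˡ; ∷-injectiveʳ; ∷-injectiveˡ)
open import Function.Base using (id; _∘_)
open import Function.Bundles using (Injection; Inverse; mk⇔)
open import Function.Definitions using (Bijective)
open import Function.Properties.Inverse using (↔⇒↣; ↔-sym)
open import Level using (0ℓ)
open import Relation.Binary.PropositionalEquality
  using (_≡_; _≢_; refl; sym; trans; cong; cong₂; subst; isEquivalence; module ≡-Reasoning)
open import Relation.Nullary.Decidable using (yes; no; map′; _⊎-dec_)
open import Relation.Nullary.Negation using (contradiction)
open import Relation.Unary using (Decidable; _≐_; _∈_; U)
open import Relation.Unary.Properties using (U?)

private
  variable
    n m d k r : ℕ

-- Vector addition over GF(2).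

⊕-comm : (x y : F^ n) → x ⊕ y ≡ y ⊕ x
⊕-comm = zipWith-comm xor-comm

⊕-assoc : (x y z : F^ n) → (x ⊕ y) ⊕ z ≡ x ⊕ (y ⊕ z)
⊕-assoc = zipWith-assoc xor-assoc

⊕-identityˡ : (x : F^ n) → 𝟎 ⊕ x ≡ x
⊕-identityˡ = zipWith-identityˡ xor-identityˡ

⊕-identityʳ : (x : F^ n) → x ⊕ 𝟎 ≡ x
⊕-identityʳ = zipWith-identityʳ xor-identityʳ

⊕-self : (x : F^ n) → x ⊕ x ≡ 𝟎
⊕-self []      = refl
⊕-self (b ∷ x) = cong₂ _∷_ (xor-same b) (⊕-self x)

⊕-cancelˡ : (x y : F^ n) → x ⊕ (x ⊕ y) ≡ y
⊕-cancelˡ x y = begin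
  x ⊕ (x ⊕ y)  ≡⟨ ⊕-assoc x x y ⟨
  x ⊕ x ⊕ y    ≡⟨ cong (_⊕ y) (⊕-self x) ⟩
  𝟎 ⊕ y        ≡⟨ ⊕-identityˡ y ⟩
  y            ∎
  where open ≡-Reasoning

⊕≡𝟎⇒≡ : {x y : F^ n} → x ⊕ y ≡ 𝟎 → x ≡ y
⊕≡𝟎⇒≡ {x = x} {y} x⊕y≡𝟎 = begin
  x            ≡⟨ ⊕-identityʳ x ⟨
  x ⊕ 𝟎        ≡⟨ cong (x ⊕_) x⊕y≡𝟎 ⟨
  x ⊕ (x ⊕ y)  ≡⟨ ⊕-cancelˡ x y ⟩
  y            ∎
  where open ≡-Reasoning

⊕-commutativeMonoid : ℕ → CommutativeMonoid 0ℓ 0ℓ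
⊕-commutativeMonoid n = record
  { Carrier = F^ n
  ; isCommutativeMonoid = record
    { isMonoid = record
      { isSemigroup = record
        { isMagma = record { isEquivalence = isEquivalence ; ∙-cong = cong₂ _⊕_ }
        ; assoc = ⊕-assoc
        }
      ; identity = ⊕-identityˡ , ⊕-identityʳ
      }
    ; comm = ⊕-comm
    }
  }

⊕-interchange : (w x y z : F^ n) → (w ⊕ x) ⊕ (y ⊕ z) ≡ (w ⊕ y) ⊕ (x ⊕ z)
⊕-interchange {n} =
  interchange (CommutativeMonoid.commutativeSemigroup (⊕-commutativeMonoid n))

𝟎++𝟎 : ∀ m {n} → 𝟎 {m} ++ 𝟎 {n} ≡ 𝟎
𝟎++𝟎 zero    = refl
𝟎++𝟎 (suc m) = cong (false ∷_) (𝟎++𝟎 m)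

-- Additive maps and linear combinations.

-- The only scalars are 0 and 1, so this already amounts to linearity; see `additive⇒·`.
Additive : (F^ n → F^ m) → Set
Additive f = ∀ x y → f (x ⊕ y) ≡ f x ⊕ f y

additive⇒𝟎 : {f : F^ n → F^ m} → Additive f → f 𝟎 ≡ 𝟎
additive⇒𝟎 {f = f} f-⊕ = begin
  f 𝟎          ≡⟨ cong f (⊕-self 𝟎) ⟨
  f (𝟎 ⊕ 𝟎)    ≡⟨ f-⊕ 𝟎 𝟎 ⟩
  f 𝟎 ⊕ f 𝟎    ≡⟨ ⊕-self (f 𝟎) ⟩
  𝟎            ∎
  where open ≡-Reasoning

true-· : (v : F^ n) → true · v ≡ v
true-· = map-id

false-· : (v : F^ n) → false · v ≡ 𝟎
false-· v = map-const v false

additive⇒· : {f : F^ n → F^ m} → Additive f → ∀ c v → f (c · v) ≡ c · f v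
additive⇒· {f = f} f-⊕ true  v = trans (cong f (true-· v)) (sym (true-· (f v)))
additive⇒· {f = f} f-⊕ false v =
  trans (cong f (false-· v)) (trans (additive⇒𝟎 f-⊕) (sym (false-· (f v))))

·-distribʳ : ∀ b c (v : F^ n) → (b xor c) · v ≡ b · v ⊕ c · v
·-distribʳ false c v =
  sym (trans (cong (_⊕ c · v) (false-· v)) (⊕-identityˡ (c · v)))
·-distribʳ true false v =
  sym (trans (cong (true · v ⊕_) (false-· v)) (⊕-identityʳ (true · v)))
·-distribʳ true true v = trans (false-· v) (sym (⊕-self (true · v)))

combination-additive : (vs : Vec (F^ n) d) → Additive (λ cs → combination cs vs)
combination-additive [] [] [] = sym (⊕-self 𝟎)
combination-additive (v ∷ vs) (b ∷ bs) (c ∷ cs) =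
  trans (cong₂ _⊕_ (·-distribʳ b c v) (combination-additive vs bs cs))
        (⊕-interchange (b · v) (c · v) (combination bs vs) (combination cs vs))

combination-++ : (bs : F^ d) (cs : F^ k) (vs : Vec (F^ n) d) (ws : Vec (F^ n) k) →
  combination (bs ++ cs) (vs ++ ws) ≡ combination bs vs ⊕ combination cs ws
combination-++ [] cs [] ws = sym (⊕-identityˡ (combination cs ws))
combination-++ (b ∷ bs) cs (v ∷ vs) ws =
  trans (cong (b · v ⊕_) (combination-++ bs cs vs ws))
        (sym (⊕-assoc (b · v) (combination bs vs) (combination cs ws)))

additive⇒combination : {f : F^ n → F^ m} → Additive f →
  (cs : F^ d) (vs : Vec (F^ n) d) → f (combination cs vs) ≡ combination cs (map f vs)
additive⇒combination f-⊕ [] [] = additive⇒𝟎 f-⊕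
additive⇒combination {f = f} f-⊕ (c ∷ cs) (v ∷ vs) =
  trans (f-⊕ (c · v) (combination cs vs))
        (cong₂ _⊕_ (additive⇒· f-⊕ c v) (additive⇒combination f-⊕ cs vs))

independent⇒injective : {vs : Vec (F^ n) d} → LinearlyIndependent vs →
  ∀ {bs cs} → combination bs vs ≡ combination cs vs → bs ≡ cs
independent⇒injective {vs = vs} indep {bs} {cs} eq = ⊕≡𝟎⇒≡ (indep (bs ⊕ cs) (begin
  combination (bs ⊕ cs) vs                   ≡⟨ combination-additive vs bs cs ⟩
  combination bs vs ⊕ combination cs vs      ≡⟨ cong (_⊕ combination cs vs) eq ⟩
  combination cs vs ⊕ combination cs vs      ≡⟨ ⊕-self (combination cs vs) ⟩
  𝟎                                          ∎))
  where open ≡-Reasoning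

-- Subspaces and rank-nullity.

Subspace : Code n → Set
Subspace V = 𝟎 ∈ V × (∀ {x y} → x ∈ V → y ∈ V → x ⊕ y ∈ V)

subspace-· : {V : Code n} → Subspace V → ∀ c {v} → v ∈ V → c · v ∈ V
subspace-· {V = V} _ true {v} v∈V = subst V (sym (true-· v)) v∈V
subspace-· {V = V} (𝟎∈V , _) false {v} _ = subst V (sym (false-· v)) 𝟎∈V

hasDimension-resp-≐ : {V W : Code n} → V ≐ W → HasDimension V d → HasDimension W d
hasDimension-resp-≐ (V⊆W , W⊆V) (vs , indep , (⊆V , V⊆)) =
  vs , indep , ((λ s → V⊆W (⊆V s)) , λ w → V⊆ (W⊆V w))

Kernel : (F^ n → F^ m) → Code n → Code n
Kernel f V v = v ∈ V × f v ≡ 𝟎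

Image : (F^ n → F^ m) → Code n → Code m
Image f V u = ∃[ v ] v ∈ V × f v ≡ u

-- Supplies the preimages of an image basis in `rank-nullity`. The hypothesis speaks of all
-- combinations because `Span us ≐ Image f V` provides it in that form; a leading coefficient
-- `false` passes it on to the tail of `us`.
lift : (f : F^ n → F^ m) {V : Code n} → Subspace V → (us : Vec (F^ m) d) →
  (∀ cs → combination cs us ∈ Image f V) →
  ∃[ ls ] map f ls ≡ us × (∀ cs → combination cs ls ∈ V)
lift f sub [] us⊆ = [] , refl , λ { [] → proj₁ sub }
lift f {V} sub (u ∷ us) us⊆ =
  -- These coefficients single out `u` itself.
  let v , v∈V , fv≡ = us⊆ (true ∷ 𝟎)
      ls , map≡ , ls⊆V = lift f sub us λ cs →
        subst (Image f V) (trans (cong (_⊕ combination cs us) (false-· u)) (⊕-identityˡ _))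
          (us⊆ (false ∷ cs))
  in v ∷ ls
   , cong₂ _∷_ (trans fv≡ (trans
       (cong₂ _⊕_ (true-· u) (additive⇒𝟎 (combination-additive us))) (⊕-identityʳ u))) map≡
   , λ { (c ∷ cs) → proj₂ sub (subspace-· sub c v∈V) (ls⊆V cs) }

-- Lifts `ls` of a basis of the image, followed by a basis `ws` of the null space, form a basis of
-- `V`.
rank-nullity : {f : F^ n → F^ m} {V : Code n} → Additive f → Subspace V →
  HasDimension (Kernel f V) d → HasDimension (Image f V) k → HasDimension V (k + d)
rank-nullity {d = d} {k = k} {f = f} {V = V} f-⊕ sub
  (ws , ws-indep , (ws⊆ , ⊆ws)) (us , us-indep , (us⊆ , ⊆us)) =
  ls ++ ws , indep , (span⊆V , V⊆span)
  where
  open ≡-Reasoning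

  lifted = lift f sub us (λ cs → us⊆ (cs , refl))
  ls = proj₁ lifted

  f-ls : ∀ cs → f (combination cs ls) ≡ combination cs us
  f-ls cs = trans (additive⇒combination f-⊕ cs ls)
                  (cong (combination cs) (proj₁ (proj₂ lifted)))

  ls⊆V : ∀ cs → combination cs ls ∈ V
  ls⊆V = proj₂ (proj₂ lifted)

  split : ∀ cs → combination cs (ls ++ ws) ≡
    combination (take k cs) ls ⊕ combination (drop k cs) ws
  split cs = trans (cong (λ cs → combination cs (ls ++ ws)) (sym (take++drop≡id k cs)))
                   (combination-++ (take k cs) (drop k cs) ls ws)

  indep : LinearlyIndependent (ls ++ ws)
  indep cs cs≡𝟎 = begin
    cs                    ≡⟨ take++drop≡id k cs ⟨
    take k cs ++ drop k cs ≡⟨ cong₂ _++_ as≡𝟎 bs≡𝟎 ⟩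
    𝟎 {k} ++ 𝟎 {d}        ≡⟨ 𝟎++𝟎 k ⟩
    𝟎                     ∎
    where
    as = take k cs
    bs = drop k cs

    -- Applying `f` kills the `ws` part and leaves a vanishing combination of the independent `us`.
    as≡𝟎 : as ≡ 𝟎
    as≡𝟎 = us-indep as (begin
      combination as us                                  ≡⟨ f-ls as ⟨
      f (combination as ls)                              ≡⟨ ⊕-identityʳ _ ⟨
      f (combination as ls) ⊕ 𝟎                          ≡⟨ cong (f (combination as ls) ⊕_)
                                                              (proj₂ (ws⊆ (bs , refl))) ⟨
      f (combination as ls) ⊕ f (combination bs ws)      ≡⟨ f-⊕ _ _ ⟨
      f (combination as ls ⊕ combination bs ws)          ≡⟨ cong f (split cs) ⟨
      f (combination cs (ls ++ ws))                      ≡⟨ cong f cs≡𝟎 ⟩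
      f 𝟎                                                ≡⟨ additive⇒𝟎 f-⊕ ⟩
      𝟎                                                  ∎)

    bs≡𝟎 : bs ≡ 𝟎
    bs≡𝟎 = ws-indep bs (begin
      combination bs ws                          ≡⟨ ⊕-identityˡ _ ⟨
      𝟎 ⊕ combination bs ws                      ≡⟨ cong (_⊕ combination bs ws)
                                                      (additive⇒𝟎 (combination-additive ls)) ⟨
      combination 𝟎 ls ⊕ combination bs ws       ≡⟨ cong (λ as → combination as ls
                                                             ⊕ combination bs ws) as≡𝟎 ⟨
      combination as ls ⊕ combination bs ws      ≡⟨ split cs ⟨
      combination cs (ls ++ ws)                  ≡⟨ cs≡𝟎 ⟩
      𝟎                                          ∎)

  span⊆V : ∀ {v} → Span (ls ++ ws) v → v ∈ V
  span⊆V (cs , refl) = subst V (sym (split cs))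
    (proj₂ sub (ls⊆V (take k cs)) (proj₁ (ws⊆ (drop k cs , refl))))

  V⊆span : ∀ {v} → v ∈ V → Span (ls ++ ws) v
  V⊆span {v} v∈V =
    -- The vector `x` has the same image as `v`, so their difference, which is `x ⊕ v` over GF(2),
    -- lies in the null space and is spanned by `ws`.
    let as , fv≡ = ⊆us (v , v∈V , refl)
        x = combination as ls
        bs , x⊕v≡ = ⊆ws (proj₂ sub (ls⊆V as) v∈V , (begin
          f (x ⊕ v)  ≡⟨ f-⊕ x v ⟩
          f x ⊕ f v  ≡⟨ cong₂ _⊕_ (f-ls as) fv≡ ⟩
          combination as us ⊕ combination as us  ≡⟨ ⊕-self _ ⟩
          𝟎          ∎))
    in as ++ bs , (begin
      v                          ≡⟨ ⊕-cancelˡ x v ⟨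
      x ⊕ (x ⊕ v)                ≡⟨ cong (x ⊕_) x⊕v≡ ⟩
      x ⊕ combination bs ws      ≡⟨ combination-++ as bs ls ws ⟨
      combination (as ++ bs) (ls ++ ws) ∎)

-- Existence of a dimension.

hasDimension-trivial : {V : Code n} → 𝟎 ∈ V → (∀ {v} → v ∈ V → v ≡ 𝟎) → HasDimension V 0
hasDimension-trivial {V = V} 𝟎∈V V⊆𝟎 =
  [] , (λ { [] _ → refl }) , ((λ { ([] , refl) → 𝟎∈V }) , λ v∈V → [] , V⊆𝟎 v∈V)

hasDimension-line : {V : Code n} {x : F^ n} → x ≢ 𝟎 → 𝟎 ∈ V → x ∈ V →
  (∀ {v} → v ∈ V → v ≡ 𝟎 ⊎ v ≡ x) → HasDimension V 1
hasDimension-line {V = V} {x} x≢𝟎 𝟎∈V x∈V V⊆ =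
  x ∷ [] , indep , ((λ { (cs , refl) → span⊆V cs }) , λ v∈V → V⊆span (V⊆ v∈V))
  where
  true-combination : combination (true ∷ []) (x ∷ []) ≡ x
  true-combination = trans (⊕-identityʳ _) (true-· x)

  false-combination : combination (false ∷ []) (x ∷ []) ≡ 𝟎
  false-combination = trans (⊕-identityʳ _) (false-· x)

  indep : LinearlyIndependent (x ∷ [])
  indep (true ∷ [])  eq = contradiction (trans (sym true-combination) eq) x≢𝟎
  indep (false ∷ []) eq = refl

  span⊆V : ∀ cs → combination cs (x ∷ []) ∈ V
  span⊆V (true ∷ [])  = subst V (sym true-combination) x∈V
  span⊆V (false ∷ []) = subst V (sym false-combination) 𝟎∈V

  V⊆span : ∀ {v} → v ≡ 𝟎 ⊎ v ≡ x → Span (x ∷ []) v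
  V⊆span (inj₁ refl) = false ∷ [] , sym false-combination
  V⊆span (inj₂ refl) = true ∷ [] , sym true-combination

tail-additive : Additive {suc n} tail
tail-additive (_ ∷ _) (_ ∷ _) = refl

image-subspace : {f : F^ n → F^ m} {V : Code n} → Additive f → Subspace V → Subspace (Image f V)
image-subspace f-⊕ (𝟎∈V , V-⊕) = (𝟎 , 𝟎∈V , additive⇒𝟎 f-⊕) ,
  λ { (x , x∈V , refl) (y , y∈V , refl) → x ⊕ y , V-⊕ x∈V y∈V , f-⊕ x y }

-- Induction on the length: dropping the first coordinate maps `V` onto a subspace of `F^ n`, and
-- rank-nullity adds the dimension of the null space of `tail` on `V`.
subspace-dimension : {V : Code n} → Subspace V → Decidable V → ∃[ d ] HasDimension V d
subspace-dimension {zero} (𝟎∈V , _) V? = 0 , hasDimension-trivial 𝟎∈V λ { {[]} _ → refl }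
subspace-dimension {suc n} {V} sub@(𝟎∈V , _) V? =
  let k , image-dim  = subspace-dimension (image-subspace tail-additive sub) image?
      d , kernel-dim = kernel
  in k + d , rank-nullity tail-additive sub kernel-dim image-dim
  where
  -- A vector has only two candidate preimages under `tail`, so decidability survives the induction.
  image? : Decidable (Image tail V)
  image? u = map′
    (λ { (inj₁ p) → true ∷ u , p , refl ; (inj₂ p) → false ∷ u , p , refl })
    (λ { (true ∷ _ , p , refl) → inj₁ p ; (false ∷ _ , p , refl) → inj₂ p })
    (V? (true ∷ u) ⊎-dec V? (false ∷ u))

  -- Only `𝟎` and `true ∷ 𝟎` have tail `𝟎`, so the dimension is 1 or 0 according to whether
  -- `true ∷ 𝟎` is in `V`.
  kernel : ∃[ d ] HasDimension (Kernel tail V) d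
  kernel with V? (true ∷ 𝟎)
  ... | yes p = 1 , hasDimension-line {x = true ∷ 𝟎} (λ ()) (𝟎∈V , refl) (p , refl)
    λ { {true ∷ _} (_ , refl) → inj₂ refl ; {false ∷ _} (_ , refl) → inj₁ refl }
  ... | no ¬p = 0 , hasDimension-trivial (𝟎∈V , refl)
    λ { {true ∷ _} (p , refl) → contradiction p ¬p ; {false ∷ _} (_ , refl) → refl }

-- Counting vectors and uniqueness of dimension.

unique-↭ : {A : Set} {xs ys : List A} → Unique xs → Unique ys →
  (∀ {x} → x ∈ˡ xs → x ∈ˡ ys) → (∀ {x} → x ∈ˡ ys → x ∈ˡ xs) → xs ↭ ys
unique-↭ xs! ys! xs⊆ys ys⊆xs = ∼bag⇒↭ (unique∧set⇒bag xs! ys! (mk⇔ xs⊆ys ys⊆xs))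

index-injective : {a b : F^ r} → index a ≡ index b → a ≡ b
index-injective {r} = Injection.injective (↔⇒↣ (coordinates r))

∈-vectors : (a : F^ r) → a ∈ˡ vectors r
∈-vectors {r} a = subst (_∈ˡ vectors r) (Inverse.strictlyInverseʳ (coordinates r) a)
  (∈-map⁺ (Inverse.from (coordinates r)) (∈-allFin (index a)))

vectors-unique : ∀ r → Unique (vectors r)
vectors-unique r =
  Unique.map⁺ (Injection.injective (↔⇒↣ (↔-sym (coordinates r)))) (Unique.allFin⁺ (2 ^ r))

length-vectors : ∀ r → length (vectors r) ≡ 2 ^ r
length-vectors r = trans (length-map (Inverse.from (coordinates r)) (List.allFin (2 ^ r)))
                         (length-tabulate id)

-- A basis makes `combination` a bijection from the coefficient vectors in `F^ d` onto `V`, so the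
-- two duplicate-free enumerations are permutations of each other.
hasDimension⇒length : {V : Code n} (V? : Decidable V) → HasDimension V d →
  length (filter V? (vectors n)) ≡ 2 ^ d
hasDimension⇒length {n} {d} {V} V? (vs , indep , (span⊆V , V⊆span)) = begin
  length (filter V? (vectors n))         ≡⟨ ↭-length (unique-↭ filter! map! to from) ⟩
  length (List.map combine (vectors d))  ≡⟨ length-map combine (vectors d) ⟩
  length (vectors d)                     ≡⟨ length-vectors d ⟩
  2 ^ d                                  ∎
  where
  open ≡-Reasoning

  combine : F^ d → F^ n
  combine cs = combination cs vs

  filter! : Unique (filter V? (vectors n))
  filter! = Unique.filter⁺ V? (vectors-unique n)

  map! : Unique (List.map combine (vectors d))
  map! = Unique.map⁺ (independent⇒injective indep) (vectors-unique d)

  to : ∀ {v} → v ∈ˡ filter V? (vectors n) → v ∈ˡ List.map combine (vectors d)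
  to v∈ with V⊆span (proj₂ (∈-filter⁻ V? {xs = vectors n} v∈))
  ... | cs , refl = ∈-map⁺ combine (∈-vectors cs)

  from : ∀ {v} → v ∈ˡ List.map combine (vectors d) → v ∈ˡ filter V? (vectors n)
  from v∈ with ∈-map⁻ combine v∈
  ... | cs , _ , refl = ∈-filter⁺ V? (∈-vectors _) (span⊆V (cs , refl))

2^-injective : ∀ {m n} → 2 ^ m ≡ 2 ^ n → m ≡ n
2^-injective {m} {n} eq =
  trans (sym (⌊log₂[2^n]⌋≡n m)) (trans (cong ⌊log₂_⌋ eq) (⌊log₂[2^n]⌋≡n n))

hasDimension-unique : {V : Code n} → Decidable V → HasDimension V d → HasDimension V k → d ≡ k
hasDimension-unique V? dim-d dim-k =
  2^-injective (trans (sym (hasDimension⇒length V? dim-d)) (hasDimension⇒length V? dim-k))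

hasDimension-≤ : {V : Code n} → Decidable V → HasDimension V d → d ≤ n
hasDimension-≤ {n} {d} {V} V? dim-d = begin
  d                                              ≡⟨ ⌊log₂[2^n]⌋≡n d ⟨
  ⌊log₂ 2 ^ d ⌋                                  ≡⟨ cong ⌊log₂_⌋ (hasDimension⇒length V? dim-d) ⟨
  ⌊log₂ length (filter V? (vectors n)) ⌋         ≤⟨ ⌊log₂⌋-mono-≤ (length-filter V? (vectors n)) ⟩
  ⌊log₂ length (vectors n) ⌋                     ≡⟨ cong ⌊log₂_⌋ (length-vectors n) ⟩
  ⌊log₂ 2 ^ n ⌋                                  ≡⟨ ⌊log₂[2^n]⌋≡n n ⟩
  n                                              ∎
  where open ≤-Reasoning

-- Some dimension exists by `subspace-dimension`, and counting all `2 ^ n` vectors forces it to be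
-- `n`.
hasDimension-full : ∀ n → HasDimension {n} U n
hasDimension-full n =
  let d , dim-d = subspace-dimension {V = U} (_ , _) U?
  in subst (HasDimension U) (2^-injective (begin
       2 ^ d                           ≡⟨ hasDimension⇒length U? dim-d ⟨
       length (filter U? (vectors n))  ≡⟨ cong length
                                            (filter-all U? (All.universal-U (vectors n))) ⟩
       length (vectors n)              ≡⟨ length-vectors n ⟩
       2 ^ n                           ∎)) dim-d
  where open ≡-Reasoning

-- Rank-nullity on the whole space, compared with its known dimension. The result is an equation
-- `n ≡ m + d` rather than `d ≡ n ∸ m`, which avoids truncated subtraction.
surjection-kernel : {f : F^ n → F^ m} → Additive f → (∀ u → ∃[ v ] f v ≡ u) →
  ∃[ d ] HasDimension (λ v → f v ≡ 𝟎) d × n ≡ m + d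
surjection-kernel {n} {m} {f} f-⊕ surj =
  let d , kernel-dim = subspace-dimension kernel-subspace (λ v → f v ≟ᵛ 𝟎)
      full-dim = rank-nullity {V = U} f-⊕ (_ , _)
        (hasDimension-resp-≐ ((_ ,_) , proj₂) kernel-dim)
        (hasDimension-resp-≐ ((λ {u} _ → let v , fv≡u = surj u in v , _ , fv≡u) , _)
          (hasDimension-full m))
  in d , kernel-dim , hasDimension-unique U? (hasDimension-full n) full-dim
  where
  kernel-subspace : Subspace (λ v → f v ≡ 𝟎)
  kernel-subspace = additive⇒𝟎 f-⊕ ,
    λ fx≡𝟎 fy≡𝟎 → trans (f-⊕ _ _) (trans (cong₂ _⊕_ fx≡𝟎 fy≡𝟎) (⊕-self 𝟎))

-- Support sums, parities and syndromes.

-- The filtered list in `supportSum` varies with the word; with coefficients in place of the filter,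
-- every summand is visibly linear in `c`.
selectedSum : F^ (2 ^ r) → List (F^ r) → F^ r
selectedSum c = List.foldr (λ a s → lookup c (index a) · a ⊕ s) 𝟎

supportSum≡selectedSum : (c : F^ (2 ^ r)) → supportSum c ≡ selectedSum c (vectors r)
supportSum≡selectedSum {r} c = go (vectors r)
  where
  go : (as : List (F^ r)) →
    List.foldr _⊕_ 𝟎 (filter (λ a → lookup c (index a) ≟ᵇ true) as) ≡ selectedSum c as
  go List.[] = refl
  go (a List.∷ as) with lookup c (index a)
  ... | true  = cong₂ _⊕_ (sym (true-· a)) (go as)
  ... | false = trans (go as) (sym (trans (cong (_⊕ selectedSum c as) (false-· a)) (⊕-identityˡ _)))

selectedSum-additive : (as : List (F^ r)) → Additive (λ c → selectedSum c as)
selectedSum-additive List.[] x y = sym (⊕-self 𝟎)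
selectedSum-additive (a List.∷ as) x y = trans
  (cong₂ _⊕_ (trans (cong (_· a) (lookup-zipWith _xor_ (index a) x y))
                    (·-distribʳ (lookup x (index a)) (lookup y (index a)) a))
             (selectedSum-additive as x y))
  (⊕-interchange (lookup x (index a) · a) (lookup y (index a) · a) _ _)

supportSum-additive : Additive (supportSum {r})
supportSum-additive {r} x y = begin
  supportSum (x ⊕ y)                                     ≡⟨ supportSum≡selectedSum (x ⊕ y) ⟩
  selectedSum (x ⊕ y) (vectors r)                        ≡⟨ selectedSum-additive (vectors r) x y ⟩
  selectedSum x (vectors r) ⊕ selectedSum y (vectors r)  ≡⟨ cong₂ _⊕_ (supportSum≡selectedSum x)
                                                                     (supportSum≡selectedSum y) ⟨
  supportSum x ⊕ supportSum y                            ∎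
  where open ≡-Reasoning

-- The support of `e a` is the single coordinate of `a`, and `vectors r` lists `a` exactly once, so
-- the filter returns the singleton list.
supportSum-e : (a : F^ r) → supportSum (e a) ≡ a
supportSum-e {r} a = trans
  (cong (List.foldr _⊕_ 𝟎) (↭-singleton-inv (unique-↭
    (Unique.filter⁺ selected? (vectors-unique r)) (All.[] AllPairs.∷ AllPairs.[]) to from)))
  (⊕-identityʳ a)
  where
  selected? : Decidable (λ b → lookup (e a) (index b) ≡ true)
  selected? b = lookup (e a) (index b) ≟ᵇ true

  to : ∀ {b} → b ∈ˡ filter selected? (vectors r) → b ∈ˡ [ a ]
  to b∈ = here (index-injective (x∈⁅y⁆⇒x≡y (index a)
    (lookup⇒[]= _ (e a) (proj₂ (∈-filter⁻ selected? {xs = vectors r} b∈)))))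

  from : ∀ {b} → b ∈ˡ [ a ] → b ∈ˡ filter selected? (vectors r)
  from (here refl) = ∈-filter⁺ selected? (∈-vectors a) ([]=⇒lookup (x∈⁅x⁆ (index a)))

parity : F^ n → Bool
parity = foldr′ _xor_ false

-- The interchange law of _xor_ is read off from that of _⊕_ in F^ 1.
parity-⊕ : (x y : F^ n) → parity (x ⊕ y) ≡ parity x xor parity y
parity-⊕ [] [] = refl
parity-⊕ (a ∷ x) (b ∷ y) = trans (cong ((a xor b) xor_) (parity-⊕ x y))
  (∷-injectiveˡ (⊕-interchange (a ∷ []) (b ∷ []) (parity x ∷ []) (parity y ∷ [])))

odd : ℕ → Bool
odd zero    = false
odd (suc n) = not (odd n)

parity≡odd : (x : F^ n) → parity x ≡ odd (wt x)
parity≡odd []          = refl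
parity≡odd (true ∷ x)  = cong not (parity≡odd x)
parity≡odd (false ∷ x) = parity≡odd x

2∣⇒¬odd : 2 ∣ n → odd n ≡ false
2∣⇒¬odd (divides zero refl)    = refl
2∣⇒¬odd (divides (suc q) refl) = trans (not-involutive _) (2∣⇒¬odd (divides q refl))

¬odd⇒2∣ : ∀ n → odd n ≡ false → 2 ∣ n
¬odd⇒2∣ zero          _  = 2 ∣0
¬odd⇒2∣ (suc (suc n)) eq = ∣m∣n⇒∣m+n ∣-refl (¬odd⇒2∣ n (trans (sym (not-involutive _)) eq))

-- The syndrome for the parity-check matrix of the extended Hamming code, whose column at coordinate
-- `a` is `true ∷ a`.
syndrome : F^ (2 ^ r) → F^ (suc r)
syndrome c = parity c ∷ supportSum c

syndrome-additive : Additive (syndrome {r})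
syndrome-additive x y = cong₂ _∷_ (parity-⊕ x y) (supportSum-additive x y)

syndrome-e : (a : F^ r) → syndrome (e a) ≡ true ∷ a
syndrome-e a = cong₂ _∷_ (trans (parity≡odd (e a)) (cong odd (∣⁅x⁆∣≡1 (index a)))) (supportSum-e a)

shift : F^ r → F^ (2 ^ r)
shift {r} a = e a ⊕ e {r} 𝟎

syndrome-shift : (a : F^ r) → syndrome (shift a) ≡ false ∷ a
syndrome-shift {r} a = trans (syndrome-additive (e a) (e {r} 𝟎))
  (trans (cong₂ _⊕_ (syndrome-e a) (syndrome-e {r} 𝟎)) (cong (false ∷_) (⊕-identityʳ a)))

syndrome-surjective : (s : F^ (suc r)) → ∃[ c ] syndrome c ≡ s
syndrome-surjective (true ∷ a)  = e a , syndrome-e a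
syndrome-surjective (false ∷ a) = shift a , syndrome-shift a

ℋ⇒syndrome : {c : F^ (2 ^ r)} → c ∈ ℋ r → syndrome c ≡ 𝟎
ℋ⇒syndrome {c = c} (sum≡𝟎 , 2∣wt) =
  cong₂ _∷_ (trans (parity≡odd c) (2∣⇒¬odd 2∣wt)) sum≡𝟎

syndrome⇒ℋ : {c : F^ (2 ^ r)} → syndrome c ≡ 𝟎 → c ∈ ℋ r
syndrome⇒ℋ {c = c} eq =
  ∷-injectiveʳ eq , ¬odd⇒2∣ (wt c) (trans (sym (parity≡odd c)) (∷-injectiveˡ eq))

ℋ[]⇒syndrome : {a : F^ r} {c : F^ (2 ^ r)} → c ∈ ℋ[ a ] → syndrome c ≡ false ∷ a
ℋ[]⇒syndrome {a = a} (h , h∈ℋ , refl) = trans (syndrome-additive (shift a) h)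
  (trans (cong₂ _⊕_ (syndrome-shift a) (ℋ⇒syndrome {c = h} h∈ℋ)) (⊕-identityʳ (false ∷ a)))

-- Words with equal syndromes differ by a word of syndrome `𝟎`, that is by a word of `ℋ r`; here `c`
-- is compared with the coset representative `shift a`.
syndrome⇒ℋ[] : {a : F^ r} {c : F^ (2 ^ r)} → syndrome c ≡ false ∷ a → c ∈ ℋ[ a ]
syndrome⇒ℋ[] {a = a} {c} eq = shift a ⊕ c
  , syndrome⇒ℋ {c = shift a ⊕ c} (trans (syndrome-additive (shift a) c)
      (trans (cong₂ _⊕_ (syndrome-shift a) eq) (⊕-self (false ∷ a))))
  , sym (⊕-cancelˡ (shift a) c)

take-drop-++ : (x : F^ n) (y : F^ m) → take n (x ++ y) ≡ x × drop n (x ++ y) ≡ y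
take-drop-++ {n} x y = ++-injective (take n (x ++ y)) x (take++drop≡id n (x ++ y))

-- Star preservation as linearity, and the deficiency.

-- If `τ 𝟎 ≡ 𝟎`, these are the linear structures of `τ`: the vectors `a` for which the derivative
-- `τ (a ⊕ b) ⊕ τ b` is constant in `b`.
LinearAt : (F^ r → F^ r) → Code r
LinearAt τ a = ∀ b → τ (a ⊕ b) ≡ τ a ⊕ τ b

module _ {τ : F^ r → F^ r} (τ𝟎 : τ 𝟎 ≡ 𝟎) where

  𝟎-linearAt : 𝟎 ∈ LinearAt τ
  𝟎-linearAt b = begin
    τ (𝟎 ⊕ b)    ≡⟨ cong τ (⊕-identityˡ b) ⟩
    τ b          ≡⟨ ⊕-identityˡ (τ b) ⟨
    𝟎 ⊕ τ b      ≡⟨ cong (_⊕ τ b) τ𝟎 ⟨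
    τ 𝟎 ⊕ τ b    ∎
    where open ≡-Reasoning

  linearAt-subspace : Subspace (LinearAt τ)
  linearAt-subspace = 𝟎-linearAt , λ {x} {y} x-lin y-lin b → begin
    τ (x ⊕ y ⊕ b)        ≡⟨ cong τ (⊕-assoc x y b) ⟩
    τ (x ⊕ (y ⊕ b))      ≡⟨ x-lin (y ⊕ b) ⟩
    τ x ⊕ τ (y ⊕ b)      ≡⟨ cong (τ x ⊕_) (y-lin b) ⟩
    τ x ⊕ (τ y ⊕ τ b)    ≡⟨ ⊕-assoc (τ x) (τ y) (τ b) ⟨
    τ x ⊕ τ y ⊕ τ b      ≡⟨ cong (_⊕ τ b) (x-lin y) ⟨
    τ (x ⊕ y) ⊕ τ b      ∎
    where open ≡-Reasoning

∈⟅⟆⁻ : {a b c x : F^ r} → index x ∈ˢ ⟅ a , b , c ⟆ → x ≡ a ⊎ x ≡ b ⊎ x ≡ c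
∈⟅⟆⁻ {a = a} {b} {c} x∈ with x∈p∪q⁻ ⁅ index a ⁆ (⁅ index b ⁆ ∪ ⁅ index c ⁆) x∈
... | inj₁ x∈a = inj₁ (index-injective (x∈⁅y⁆⇒x≡y (index a) x∈a))
... | inj₂ x∈bc with x∈p∪q⁻ ⁅ index b ⁆ ⁅ index c ⁆ x∈bc
...   | inj₁ x∈b = inj₂ (inj₁ (index-injective (x∈⁅y⁆⇒x≡y (index b) x∈b)))
...   | inj₂ x∈c = inj₂ (inj₂ (index-injective (x∈⁅y⁆⇒x≡y (index c) x∈c)))

second∈⟅⟆ : (a b c : F^ r) → index b ∈ˢ ⟅ a , b , c ⟆
second∈⟅⟆ a b c = x∈p∪q⁺ (inj₂ (x∈p∪q⁺ (inj₁ (x∈⁅x⁆ (index b)))))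

third∈⟅⟆ : (a b c : F^ r) → index c ∈ˢ ⟅ a , b , c ⟆
third∈⟅⟆ a b c = x∈p∪q⁺ (inj₂ (x∈p∪q⁺ {p = ⁅ index b ⁆} (inj₂ (x∈⁅x⁆ (index c)))))

-- Both `x` and `y` differ from `a`, so each is `c` or `a ⊕ c`; being distinct they take one value
-- each, and either way they differ by `a`.
⟅⟆≡line⇒⊕ : {a x y c : F^ r} → x ≢ a → y ≢ a → y ≢ x →
  ⟅ a , x , y ⟆ ≡ ⟅ a , c , a ⊕ c ⟆ → y ≡ a ⊕ x
⟅⟆≡line⇒⊕ {a = a} {x} {y} {c} x≢a y≢a y≢x eq
  with ∈⟅⟆⁻ (subst (index x ∈ˢ_) eq (second∈⟅⟆ a x y))
     | ∈⟅⟆⁻ (subst (index y ∈ˢ_) eq (third∈⟅⟆ a x y))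
... | inj₁ x≡a          | _                 = contradiction x≡a x≢a
... | inj₂ _            | inj₁ y≡a          = contradiction y≡a y≢a
... | inj₂ (inj₁ x≡c)   | inj₂ (inj₁ y≡c)   = contradiction (trans y≡c (sym x≡c)) y≢x
... | inj₂ (inj₁ x≡c)   | inj₂ (inj₂ y≡a⊕c) = trans y≡a⊕c (cong (a ⊕_) (sym x≡c))
... | inj₂ (inj₂ x≡a⊕c) | inj₂ (inj₁ y≡c)   =
  trans y≡c (sym (trans (cong (a ⊕_) x≡a⊕c) (⊕-cancelˡ a c)))
... | inj₂ (inj₂ x≡a⊕c) | inj₂ (inj₂ y≡a⊕c) = contradiction (trans y≡a⊕c (sym x≡a⊕c)) y≢x

x⊕y≡x⇒y≡𝟎 : {x y : F^ n} → x ⊕ y ≡ x → y ≡ 𝟎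
x⊕y≡x⇒y≡𝟎 {x = x} {y} eq = trans (sym (⊕-cancelˡ x y)) (trans (cong (x ⊕_) eq) (⊕-self x))

module _ {τ : F^ r → F^ r} (τ-bijective : Bijective _≡_ _≡_ τ) (τ𝟎 : τ 𝟎 ≡ 𝟎) where

  private
    τ-injective : ∀ {a b} → τ a ≡ τ b → a ≡ b
    τ-injective = proj₁ τ-bijective

    τ-≢ : ∀ {a b} → a ≢ b → τ a ≢ τ b
    τ-≢ a≢b τa≡τb = a≢b (τ-injective τa≡τb)

  -- The cases `b ≡ 𝟎` and `b ≡ a` give no triple and follow from `τ 𝟎 ≡ 𝟎`. Otherwise injectivity
  -- keeps the three image points distinct, and a triple in the star of `τ a` has `τ a` plus its
  -- second point as its third.
  preservesStar⇒linearAt : ∀ {a} → PreservesStar τ a → a ∈ LinearAt τ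
  preservesStar⇒linearAt {a} (a≢𝟎 , image⊆star , _) b with b ≟ᵛ 𝟎 | b ≟ᵛ a
  ... | yes refl | _ = begin
    τ (a ⊕ 𝟎)    ≡⟨ cong τ (⊕-identityʳ a) ⟩
    τ a          ≡⟨ ⊕-identityʳ (τ a) ⟨
    τ a ⊕ 𝟎      ≡⟨ cong (τ a ⊕_) τ𝟎 ⟨
    τ a ⊕ τ 𝟎    ∎
    where open ≡-Reasoning
  ... | no _ | yes refl = begin
    τ (a ⊕ a)    ≡⟨ cong τ (⊕-self a) ⟩
    τ 𝟎          ≡⟨ τ𝟎 ⟩
    𝟎            ≡⟨ ⊕-self (τ a) ⟨
    τ a ⊕ τ a    ∎
    where open ≡-Reasoning
  ... | no b≢𝟎 | no b≢a =
    let c , _ , _ , eq = image⊆star (b , b≢𝟎 , b≢a , refl)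
    in ⟅⟆≡line⇒⊕ {c = c} (τ-≢ b≢a)
         (τ-≢ λ a⊕b≡a → b≢𝟎 (x⊕y≡x⇒y≡𝟎 a⊕b≡a))
         (τ-≢ λ a⊕b≡b → a≢𝟎 (x⊕y≡x⇒y≡𝟎 (trans (⊕-comm b a) a⊕b≡b)))
         eq

  linearAt⇒preservesStar : ∀ {a} → a ≢ 𝟎 → a ∈ LinearAt τ → PreservesStar τ a
  linearAt⇒preservesStar {a} a≢𝟎 lin = a≢𝟎 , image⊆star , star⊆image
    where
    image⊆star : ∀ {B} → StarImage τ a B → Star (τ a) B
    image⊆star (b , b≢𝟎 , b≢a , refl) = τ b
      , (λ τb≡𝟎 → b≢𝟎 (τ-injective (trans τb≡𝟎 (sym τ𝟎))))
      , τ-≢ b≢a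
      , cong ⟅ τ a , τ b ,_⟆ (lin b)

    -- Surjectivity writes the second point `c` of a triple as `τ b`, and linearity at `a` then
    -- matches the third points.
    star⊆image : ∀ {B} → Star (τ a) B → StarImage τ a B
    star⊆image (c , c≢𝟎 , c≢τa , refl) with proj₂ τ-bijective c
    ... | b , τ-b with τ-b refl
    ...   | refl = b
      , (λ b≡𝟎 → c≢𝟎 (trans (cong τ b≡𝟎) τ𝟎))
      , (λ b≡a → c≢τa (cong τ b≡a))
      , cong ⟅ τ a , τ b ,_⟆ (sym (lin b))

  -- Decided through the equivalence with star preservation, with `𝟎` treated apart because
  -- `PreservesStar` excludes it.
  linearAt? : Decidable (LinearAt τ)
  linearAt? a = map′ to from (a ≟ᵛ 𝟎 ⊎-dec preservesStar? τ a)
    where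
    to : a ≡ 𝟎 ⊎ PreservesStar τ a → a ∈ LinearAt τ
    to (inj₁ refl) = 𝟎-linearAt τ𝟎
    to (inj₂ pres) = preservesStar⇒linearAt pres

    from : a ∈ LinearAt τ → a ≡ 𝟎 ⊎ PreservesStar τ a
    from lin with a ≟ᵛ 𝟎
    ... | yes a≡𝟎 = inj₁ a≡𝟎
    ... | no a≢𝟎  = inj₂ (linearAt⇒preservesStar a≢𝟎 lin)

  -- 𝟎 accounts for the + 1 in deficiency.
  linearAt-↭ : filter linearAt? (vectors r) ↭ 𝟎 List.∷ filter (preservesStar? τ) (vectors r)
  linearAt-↭ = unique-↭ (Unique.filter⁺ linearAt? (vectors-unique r))
    (All.tabulate (λ { b∈ refl →
       proj₁ (proj₂ (∈-filter⁻ (preservesStar? τ) {xs = vectors r} b∈)) refl })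
       AllPairs.∷ Unique.filter⁺ (preservesStar? τ) (vectors-unique r))
    to from
    where
    to : ∀ {a} → a ∈ˡ filter linearAt? (vectors r) →
      a ∈ˡ 𝟎 List.∷ filter (preservesStar? τ) (vectors r)
    to {a} a∈ with a ≟ᵛ 𝟎
    ... | yes a≡𝟎 = here a≡𝟎
    ... | no a≢𝟎 = there (∈-filter⁺ (preservesStar? τ) (∈-vectors a)
      (linearAt⇒preservesStar a≢𝟎 (proj₂ (∈-filter⁻ linearAt? {xs = vectors r} a∈))))

    from : ∀ {a} → a ∈ˡ 𝟎 List.∷ filter (preservesStar? τ) (vectors r) →
      a ∈ˡ filter linearAt? (vectors r)
    from (here refl) = ∈-filter⁺ linearAt? (∈-vectors 𝟎) (𝟎-linearAt τ𝟎)
    from {a} (there a∈) = ∈-filter⁺ linearAt? (∈-vectors a)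
      (preservesStar⇒linearAt (proj₂ (∈-filter⁻ (preservesStar? τ) {xs = vectors r} a∈)))

  deficiency≡ : HasDimension (LinearAt τ) k → deficiency τ ≡ r ∸ k
  deficiency≡ {k} dim-k = cong (r ∸_) (begin
    ⌊log₂ length stars + 1 ⌋                        ≡⟨ cong ⌊log₂_⌋ (+-comm (length stars) 1) ⟩
    ⌊log₂ suc (length stars) ⌋                      ≡⟨ cong ⌊log₂_⌋ (↭-length linearAt-↭) ⟨
    ⌊log₂ length (filter linearAt? (vectors r)) ⌋   ≡⟨ cong ⌊log₂_⌋
                                                         (hasDimension⇒length linearAt? dim-k) ⟩
    ⌊log₂ 2 ^ k ⌋                                   ≡⟨ ⌊log₂[2^n]⌋≡n k ⟩
    k                                               ∎)
    where
    open ≡-Reasoning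
    stars = filter (preservesStar? τ) (vectors r)

-- The kernel of `S τ` in terms of pairs of syndromes.

module SyndromePair (r : ℕ) where

  N : ℕ
  N = 2 ^ r

  left right : F^ (N + N) → F^ (suc r)
  left  = syndrome ∘ take N
  right = syndrome ∘ drop N

  left-additive : Additive left
  left-additive x y = trans (cong syndrome (take-zipWith _xor_ x y))
    (syndrome-additive (take N x) (take N y))

  right-additive : Additive right
  right-additive x y = trans (cong syndrome (drop-zipWith {m = N} _xor_ x y))
    (syndrome-additive (drop N x) (drop N y))

  left-right-surjective : ∀ s t → ∃[ z ] left z ≡ s × right z ≡ t
  left-right-surjective s t =
    let x , x≡ = syndrome-surjective s
        y , y≡ = syndrome-surjective t
        take≡ , drop≡ = take-drop-++ x y
    in x ++ y , trans (cong syndrome take≡) x≡ , trans (cong syndrome drop≡) y≡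

  joint : F^ (N + N) → F^ (suc r + suc r)
  joint z = left z ++ right z

  joint-additive : Additive joint
  joint-additive x y = trans (cong₂ _++_ (left-additive x y) (right-additive x y))
    (sym (zipWith-++ _xor_ (left x) (right x) (left y) (right y)))

  joint-surjective : ∀ u → ∃[ z ] joint z ≡ u
  joint-surjective u =
    let z , l≡ , r≡ = left-right-surjective (take (suc r) u) (drop (suc r) u)
    in z , trans (cong₂ _++_ l≡ r≡) (take++drop≡id (suc r) u)

  leftSum : F^ (N + N) → F^ r
  leftSum = tail ∘ left

  leftSum-additive : Additive leftSum
  leftSum-additive x y = trans (cong tail (left-additive x y)) (tail-additive (left x) (left y))

  module _ (τ : F^ r → F^ r) where

    S⇒syndromes : ∀ {z} → z ∈ S τ → ∃[ a ] left z ≡ false ∷ a × right z ≡ false ∷ τ a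
    S⇒syndromes (a , x , y , x∈ , y∈ , refl) =
      let take≡ , drop≡ = take-drop-++ x y
      in a , trans (cong syndrome take≡) (ℋ[]⇒syndrome x∈)
           , trans (cong syndrome drop≡) (ℋ[]⇒syndrome y∈)

    syndromes⇒S : ∀ {z a} → left z ≡ false ∷ a → right z ≡ false ∷ τ a → z ∈ S τ
    syndromes⇒S {z} {a} l≡ r≡ = a , take N z , drop N z
      , syndrome⇒ℋ[] l≡ , syndrome⇒ℋ[] r≡ , sym (take++drop≡id N z)

    -- An explicit form of `Ker (S τ)`: the words of `S τ` whose left support sum lies in
    -- `LinearAt τ`.
    KerS : Code (N + N)
    KerS z = ∃[ a ] a ∈ LinearAt τ × left z ≡ false ∷ a × right z ≡ false ∷ τ a

    -- Adding syndromes gives `a ⊕ b` on the left and `τ a ⊕ τ b` on the right; linearity at `a`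
    -- makes the latter `τ (a ⊕ b)`.
    S-translate : ∀ {z x} → z ∈ KerS → x ∈ S τ → z ⊕ x ∈ S τ
    S-translate {z} {x} (a , lin , lz , rz) x∈S =
      let b , lx , rx = S⇒syndromes x∈S
      in syndromes⇒S (trans (left-additive z x) (cong₂ _⊕_ lz lx))
                     (trans (right-additive z x)
                       (trans (cong₂ _⊕_ rz rx) (cong (false ∷_) (sym (lin b)))))

    KerS⊆Ker : ∀ {z} → z ∈ KerS → z ∈ Ker (S τ)
    KerS⊆Ker {z} z∈K = (λ { (x , x∈S , refl) → S-translate z∈K x∈S })
      -- Translation by `z` is its own inverse, so the same closure gives the other inclusion.
      , λ {y} y∈S → z ⊕ y , S-translate z∈K y∈S , sym (⊕-cancelˡ z y)

    module _ (τ𝟎 : τ 𝟎 ≡ 𝟎) where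

      𝟎∈S : 𝟎 ∈ S τ
      𝟎∈S = syndromes⇒S (additive⇒𝟎 {f = left} left-additive)
        (trans (additive⇒𝟎 {f = right} right-additive) (cong (false ∷_) (sym τ𝟎)))

      Ker⊆KerS : ∀ {z} → z ∈ Ker (S τ) → z ∈ KerS
      Ker⊆KerS {z} (z⊞S⊆S , _) =
        -- Translating `𝟎` shows that `z` itself is in `S τ`, which yields `a`.
        let a , lz , rz = S⇒syndromes (z⊞S⊆S (𝟎 , 𝟎∈S , sym (⊕-identityʳ z)))
        in a , lin a lz rz , lz , rz
        where
        lin : ∀ a → left z ≡ false ∷ a → right z ≡ false ∷ τ a → a ∈ LinearAt τ
        lin a lz rz b =
          -- A test word of `S τ` with left support sum `b`: its translate by `z` is in `S τ` with
          -- left sum `c`, so `c` is `a ⊕ b` and `τ c` is `τ a ⊕ τ b`.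
          let x , lx , rx = left-right-surjective (false ∷ b) (false ∷ τ b)
              c , lzx , rzx = S⇒syndromes (z⊞S⊆S (x , syndromes⇒S lx rx , refl))
              c≡ = ∷-injectiveʳ (trans (sym lzx) (trans (left-additive z x) (cong₂ _⊕_ lz lx)))
          in trans (cong τ (sym c≡))
               (∷-injectiveʳ (trans (sym rzx) (trans (right-additive z x) (cong₂ _⊕_ rz rx))))

      KerS-subspace : Subspace KerS
      KerS-subspace = (𝟎 , 𝟎-linearAt τ𝟎 , additive⇒𝟎 {f = left} left-additive
          , trans (additive⇒𝟎 {f = right} right-additive) (cong (false ∷_) (sym τ𝟎))) ,
        λ { {x} {y} (a , a-lin , lx , rx) (b , b-lin , ly , ry) →
            a ⊕ b , proj₂ (linearAt-subspace τ𝟎) a-lin b-lin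
          , trans (left-additive x y) (cong₂ _⊕_ lx ly)
          , trans (right-additive x y)
              (trans (cong₂ _⊕_ rx ry) (cong (false ∷_) (sym (a-lin b)))) }

      -- Left sum `𝟎` forces the right syndrome of a word of `KerS` to be `false ∷ τ 𝟎`, which is
      -- `𝟎`. The dimension of this space is then known from the surjectivity of `joint`.
      joint-kernel : (λ z → joint z ≡ 𝟎) ≐ Kernel leftSum KerS
      joint-kernel = to , from
        where
        to : ∀ {z} → joint z ≡ 𝟎 → z ∈ Kernel leftSum KerS
        to {z} eq =
          let l≡ , r≡ = ++-injective (left z) 𝟎 (trans eq (sym (𝟎++𝟎 (suc r))))
          in (𝟎 , 𝟎-linearAt τ𝟎 , l≡ , trans r≡ (cong (false ∷_) (sym τ𝟎)))
           , cong tail l≡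

        from : ∀ {z} → z ∈ Kernel leftSum KerS → joint z ≡ 𝟎
        from {z} ((a , _ , lz , rz) , sum≡𝟎) = trans (cong₂ _++_
            (trans lz (cong (false ∷_) a≡𝟎))
            (trans rz (cong (false ∷_) (trans (cong τ a≡𝟎) τ𝟎))))
          (𝟎++𝟎 (suc r))
          where
          a≡𝟎 : a ≡ 𝟎
          a≡𝟎 = trans (sym (cong tail lz)) sum≡𝟎

      linearAt-image : LinearAt τ ≐ Image leftSum KerS
      linearAt-image =
        (λ {a} lin → let z , l≡ , r≡ = left-right-surjective (false ∷ a) (false ∷ τ a)
                     in z , (a , lin , l≡ , r≡) , cong tail l≡)
        , λ { (z , (a , lin , l≡ , _) , refl) → subst (LinearAt τ) (sym (cong tail l≡)) lin }

lemma2 : (r : ℕ) → 1 ≤ r → (τ : F^ r → F^ r) → Bijective _≡_ _≡_ τ → τ 𝟎 ≡ 𝟎 →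
    HasDimension (Ker (S τ)) (2 ^ (r + 1) ∸ r ∸ 2 ∸ deficiency τ)
lemma2 r _ τ τ-bijective τ𝟎 =
  -- Here `k` is the dimension of `LinearAt τ`, so the deficiency is `r ∸ k`.
  let k , dim-k = subspace-dimension (linearAt-subspace τ𝟎) (linearAt? τ-bijective τ𝟎)
      d , dim-d , N+N≡ = surjection-kernel joint-additive joint-surjective
      dim-KerS = rank-nullity leftSum-additive (KerS-subspace τ τ𝟎)
        (hasDimension-resp-≐ (joint-kernel τ τ𝟎) dim-d)
        (hasDimension-resp-≐ (linearAt-image τ τ𝟎) dim-k)
  in subst (HasDimension (Ker (S τ)))
       (sym (trans (cong (2 ^ (r + 1) ∸ r ∸ 2 ∸_) (deficiency≡ τ-bijective τ𝟎 dim-k))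
                   (arith k d (hasDimension-≤ (linearAt? τ-bijective τ𝟎) dim-k) N+N≡)))
       (hasDimension-resp-≐ (KerS⊆Ker τ , Ker⊆KerS τ τ𝟎) dim-KerS)
  where
  open SyndromePair r

  -- Writing `2 ^ (r + 1)` as a sum that begins with each subtrahend in turn makes every truncated
  -- subtraction exact; `k ≤ r` is what restores `r` from `r ∸ k + k`.
  arith : ∀ k d → k ≤ r → 2 ^ r + 2 ^ r ≡ suc r + suc r + d →
    2 ^ (r + 1) ∸ r ∸ 2 ∸ (r ∸ k) ≡ k + d
  arith k d k≤r eq = begin
    2 ^ (r + 1) ∸ r ∸ 2 ∸ (r ∸ k)              ≡⟨ cong (λ m → m ∸ r ∸ 2 ∸ (r ∸ k)) 2^[r+1]≡ ⟩
    r + (2 + (r ∸ k + (k + d))) ∸ r ∸ 2 ∸ (r ∸ k)  ≡⟨ cong (λ m → m ∸ 2 ∸ (r ∸ k)) (m+n∸m≡n r _) ⟩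
    r ∸ k + (k + d) ∸ (r ∸ k)                  ≡⟨ m+n∸m≡n (r ∸ k) (k + d) ⟩
    k + d                                      ∎
    where
    open ≡-Reasoning

    2^[r+1]≡ : 2 ^ (r + 1) ≡ r + (2 + (r ∸ k + (k + d)))
    2^[r+1]≡ = begin
      2 ^ (r + 1)                     ≡⟨ cong (2 ^_) (+-comm r 1) ⟩
      2 ^ r + (2 ^ r + 0)             ≡⟨ cong (2 ^ r +_) (+-identityʳ (2 ^ r)) ⟩
      2 ^ r + 2 ^ r                   ≡⟨ eq ⟩
      suc r + suc r + d               ≡⟨ solve 2 (λ r d →
                                          (con 1 :+ r) :+ (con 1 :+ r) :+ d :=
                                          r :+ (con 2 :+ (r :+ d))) refl r d ⟩
      r + (2 + (r + d))               ≡⟨ cong (λ m → r + (2 + (m + d))) (m∸n+n≡m k≤r) ⟨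
      r + (2 + (r ∸ k + k + d))       ≡⟨ cong (λ m → r + (2 + m)) (+-assoc (r ∸ k) k d) ⟩
      r + (2 + (r ∸ k + (k + d)))     ∎
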